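{- Let $d\ge 1$ and let $k_1,\ldots,k_d$ be positive integers. Then, as $n\to\infty$, $$f(n,R^{k_1,\ldots,k_d},d)=O\left(n^{d-\alpha(k_1,\ldots,k_d)}\right),\qquad\text{where } \alpha(k_1,\ldots,k_d)=\frac{\max(k_1,\ldots,k_d)}{k_1\cdot k_2\cdots k_d}.$$
   Context: A $d$-dimensional $n_1\times\cdots\times n_d$ zero-one matrix is an array $A=(a_{i_1,\ldots,i_d})$, $1\le i_\ell\le n_\ell$, with entries in $\{0,1\}$. A submatrix is obtained by selecting, for each $\ell$, a set of values of the $\ell$-th coordinate (keeping the order). $A$ contains a $d$-dimensional zero-one matrix $P$ if some submatrix of $A$ can be transformed into $P$ by changing any number of ones to zeros; otherwise $A$ avoids $P$. $f(n,P,d)$ denotes the maximum number of ones in a $d$-dimensional $n\times\cdots\times n$ zero-one matrix that avoids $P$. $R^{k_1,\ldots,k_d}$ denotes the $d$-dimensional $k_1\times\cdots\times k_d$ matrix of all ones. The implied constant may depend on $d,k_1,\ldots,k_d$ but not on $n$. -}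

module Defs where

open import Data.Bool.Base as Bool using (Bool; true; false)
import Data.Bool.Properties as Bool
open import Data.Fin.Base using (Fin) renaming (_<_ to _<ᶠ_)
open import Data.Fin.Properties using (any?) renaming (_<?_ to _<ᶠ?_)
open import Data.Integer.Base using (+_; -[1+_])
open import Data.List.Base as List using (List)
open import Data.List.Extrema.Nat using (max; argmax-sel; xs≤max)
open import Data.List.Membership.Propositional using (_∈_)
open import Data.List.Membership.Propositional.Properties
  using (∈-cartesianProductWith⁺; ∈-filter⁺; ∈-filter⁻; ∈-map⁺; ∈-map⁻)
open import Data.List.Relation.Unary.Any using (here; there)
import Data.List.Relation.Unary.All as ListAll
open import Data.Nat.Base using (ℕ; zero; suc; _≤_; _*_; _^_; _⊔_; NonZero)
open import Data.Nat.Properties using (m*n≢0; n≤0⇒n≡0)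
open import Data.Product.Base using (Σ-syntax; ∃; ∃-syntax; _×_; _,_)
open import Data.Rational.Unnormalised.Base using (ℚᵘ; mkℚᵘ; _/_)
open import Data.Sum.Base using (inj₁; inj₂)
open import Function.Base using (id)
open import Data.Vec.Base as Vec using (Vec; []; _∷_; lookup; replicate)
open import Data.Vec.Relation.Binary.Pointwise.Inductive as Pointwise
  using (Pointwise; []; _∷_)
open import Data.Vec.Relation.Unary.All using (All; []; _∷_)
open import Data.Vec.Relation.Unary.AllPairs using (AllPairs; allPairs?)
open import Relation.Binary.PropositionalEquality using (_≡_; refl; sym; trans; subst)
open import Relation.Nullary using (¬_; Dec; yes; no)
open import Relation.Nullary.Decidable using (map′; ¬?)
open import Relation.Unary using (Decidable)

private
  variable
    d : ℕ

Matrix : Vec ℕ d → Set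
Matrix []       = Bool
Matrix (n ∷ ns) = Vec (Matrix ns) n

R : (ks : Vec ℕ d) → Matrix ks
R []       = true
R (k ∷ ks) = replicate k (R ks)

ones : (ns : Vec ℕ d) → Matrix ns → ℕ
ones []       true  = 1
ones []       false = 0
ones (n ∷ ns) A     = Vec.sum (Vec.map (ones ns) A)

-- A k-element set of values of a coordinate ranging over Fin n, listed in
-- increasing order.
Choice : ℕ → ℕ → Set
Choice n k = Σ[ is ∈ Vec (Fin n) k ] AllPairs _<ᶠ_ is

Selection : Vec ℕ d → Vec ℕ d → Set
Selection = Pointwise Choice

submatrix : {ns ks : Vec ℕ d} → Selection ns ks → Matrix ns → Matrix ks
submatrix []             a = a
submatrix ((is , _) ∷ σ) A = Vec.map (λ i → submatrix σ (lookup A i)) is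

-- Entrywise P ≤ B with false ≤ true, i.e. P arises from B by changing some
-- (possibly no) ones to zeros.
Below : (ks : Vec ℕ d) → Matrix ks → Matrix ks → Set
Below []       p b = p Bool.≤ b
Below (k ∷ ks) P B = Pointwise (Below ks) P B

Contains : (ns ks : Vec ℕ d) → Matrix ns → Matrix ks → Set
Contains ns ks A P = ∃[ σ ] Below ks P (submatrix {ns = ns} {ks} σ A)

Avoids : (ns ks : Vec ℕ d) → Matrix ns → Matrix ks → Set
Avoids ns ks A P = ¬ Contains ns ks A P

below? : (ks : Vec ℕ d) (P B : Matrix ks) → Dec (Below ks P B)
below? []       p b = p Bool.≤? b
below? (k ∷ ks) P B = Pointwise.decidable (below? ks) P B

private
  Searchable : Set → Set₁
  Searchable A = {Q : A → Set} → Decidable Q → Dec (∃ Q)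

  searchVec : {A : Set} → Searchable A → ∀ n → Searchable (Vec A n)
  searchVec search zero    Q? = map′ ([] ,_) (λ { ([] , q) → q }) (Q? [])
  searchVec search (suc n) Q? =
    map′ (λ (x , xs , q) → x ∷ xs , q) (λ { (x ∷ xs , q) → x , xs , q })
         (search λ x → searchVec search n λ xs → Q? (x ∷ xs))

  searchΣ : {A : Set} {B : A → Set} → Searchable A →
            (∀ x → Searchable (B x)) → Searchable (Σ[ x ∈ A ] B x)
  searchΣ searchA searchB Q? =
    map′ (λ (x , y , q) → (x , y) , q) (λ ((x , y) , q) → x , y , q)
         (searchA λ x → searchB x λ y → Q? (x , y))

  searchIncreasing : ∀ {n k} (is : Vec (Fin n) k) → Searchable (AllPairs _<ᶠ_ is)
  searchIncreasing is Q? with allPairs? _<ᶠ?_ is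
  ... | no ¬inc = no λ (inc , _) → ¬inc inc
  ... | yes inc = map′ (inc ,_)
                       (λ (inc′ , q) → subst _ (irrelevant <-irrelevant inc′ inc) q)
                       (Q? inc)
    where
    open import Data.Vec.Relation.Unary.AllPairs using (irrelevant)
    open import Data.Fin.Properties using (<-irrelevant)

  searchSelection : (ns ks : Vec ℕ d) → Searchable (Selection ns ks)
  searchSelection []       []       Q? = map′ ([] ,_) (λ { ([] , q) → q }) (Q? [])
  searchSelection (n ∷ ns) (k ∷ ks) Q? =
    map′ (λ (c , σ , q) → c ∷ σ , q) (λ { (c ∷ σ , q) → c , σ , q })
         (searchΣ (searchVec any? k) searchIncreasing λ c →
          searchSelection ns ks λ σ → Q? (c ∷ σ))

avoids? : (ns ks : Vec ℕ d) (P : Matrix ks) → Decidable (λ A → Avoids ns ks A P)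
avoids? ns ks P A =
  ¬? (searchSelection ns ks λ σ → below? ks P (submatrix σ A))

vectors : {A : Set} → List A → ∀ n → List (Vec A n)
vectors xs zero    = List.[ [] ]
vectors xs (suc n) = List.cartesianProductWith _∷_ xs (vectors xs n)

matrices : (ns : Vec ℕ d) → List (Matrix ns)
matrices []       = false List.∷ true List.∷ List.[]
matrices (n ∷ ns) = vectors (matrices ns) n

∈-vectors : {A : Set} {xs : List A} → (∀ x → x ∈ xs) →
            ∀ {n} (v : Vec A n) → v ∈ vectors xs n
∈-vectors all []      = here refl
∈-vectors all (x ∷ v) = ∈-cartesianProductWith⁺ _∷_ (all x) (∈-vectors all v)

∈-matrices : (ns : Vec ℕ d) (A : Matrix ns) → A ∈ matrices ns
∈-matrices []       false = here refl
∈-matrices []       true  = there (here refl)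
∈-matrices (n ∷ ns) A     = ∈-vectors (∈-matrices ns) A

cube : (d n : ℕ) → Vec ℕ d
cube d n = replicate d n

-- The maximum is over a nonempty set as soon as P has a one (the zero matrix
-- avoids P); f-upper and f-attained characterise it.
f : ℕ → (ks : Vec ℕ d) → Matrix ks → ℕ
f {d} n ks P =
  max 0 (List.map (ones ns) (List.filter (avoids? ns ks P) (matrices ns)))
  where ns = cube d n

f-upper : ∀ n (ks : Vec ℕ d) (P : Matrix ks) (A : Matrix (cube d n)) →
          Avoids (cube d n) ks A P → ones (cube d n) A ≤ f n ks P
f-upper {d} n ks P A av =
  ListAll.lookup (xs≤max 0 _)
    (∈-map⁺ (ones ns) (∈-filter⁺ (avoids? ns ks P) (∈-matrices ns A) av))
  where ns = cube d n

f-attained : ∀ n (ks : Vec ℕ d) (P : Matrix ks) →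
             ∃[ A ] Avoids (cube d n) ks A P →
             ∃[ A ] Avoids (cube d n) ks A P × ones (cube d n) A ≡ f n ks P
f-attained {d} n ks P (A , av)
  with argmax-sel id 0 (List.map (ones (cube d n))
                   (List.filter (avoids? (cube d n) ks P) (matrices (cube d n))))
... | inj₁ f≡0 = A , av , trans (n≤0⇒n≡0 (subst (_ ≤_) f≡0 (f-upper n ks P A av))) (sym f≡0)
... | inj₂ f∈
  with B , B∈ , f≡ ← ∈-map⁻ (ones (cube d n)) f∈
  with _ , avB ← ∈-filter⁻ (avoids? (cube d n) ks P) {xs = matrices (cube d n)} B∈
  = B , avB , sym f≡

maximum : Vec ℕ d → ℕ
maximum = Vec.foldr _ _⊔_ 0

product : Vec ℕ d → ℕ
product = Vec.foldr _ _*_ 1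

product≢0 : {ks : Vec ℕ d} → All NonZero ks → NonZero (product ks)
product≢0 []           = _
product≢0 (k≢0 ∷ ks≢0) = m*n≢0 _ _ {{k≢0}} {{product≢0 ks≢0}}

α : (ks : Vec ℕ d) → All NonZero ks → ℚᵘ
α ks ks≢0 = _/_ (+ maximum ks) (product ks) {{product≢0 ks≢0}}

-- x ≤ C · n ^ e for a rational exponent e = p / q, with both sides raised to
-- the power q (and n ^ e moved to the left when p < 0) so that no roots occur.
-- The inequality does not depend on which fraction represents e.
AtMost : (x C n : ℕ) → ℚᵘ → Set
AtMost x C n (mkℚᵘ (+ p)    q-1) = x ^ suc q-1 ≤ C ^ suc q-1 * n ^ p
AtMost x C n (mkℚᵘ -[1+ p ] q-1) = x ^ suc q-1 * n ^ suc p ≤ C ^ suc q-1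

-- g(n) = O(n ^ e) as n → ∞. A natural constant C loses no generality over a
-- real one.
_=O[n^_] : (ℕ → ℕ) → ℚᵘ → Set
g =O[n^ e ] = ∃[ C ] ∃[ N ] (∀ n → N ≤ n → AtMost (g n) C n e)

{-# OPTIONS --safe #-}
module Submission where

-- For every coordinate j the number of ones is O(n ^ (d - 1 / q)) with
-- q = ∏_{i ≠ j} k_i, and α is the case where k_j is the largest side. Induct on d
-- by peeling off a coordinate i ≠ j: if the array avoids R^k, the entrywise
-- conjunction of any k_i of its layers avoids the all-ones pattern in the
-- remaining coordinates and so has at most B ones. Counting pairs of a position
-- v and k_i layers that are 1 at v gives, with c_v ones above v,
--   Σ_v (c_v ∸ k_i) ^ k_i ≤ k_i ! n ^ k_i B,
-- and the power mean inequality turns this into a bound on Σ_v c_v. The base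
-- d = 1 is the coordinate j alone, where at most k_j ones occur.

open import Defs
open import Data.Integer.Base using (+_)
open import Data.Nat.Base using (ℕ; _≤_; NonZero)
open import Data.Rational.Unnormalised.Base using (_/_; _-_)
open import Data.Vec.Base using (Vec)
open import Data.Vec.Relation.Unary.All using (All)

open import Data.Bool.Base as Bool using (Bool; true; false; _∧_)
open import Data.Bool.Properties using (∧-conicalˡ; ∧-conicalʳ; ¬-not)
open import Data.Fin.Base as Fin using (Fin)
open import Data.Integer.Base as ℤ using ()
open import Data.Integer.Properties as ℤ using ()
open import Data.List.Base as List using ()
open import Data.List.Extrema.Nat using (argmax-sel)
open import Data.List.Membership.Propositional.Properties
  using () renaming (∈-filter⁻ to ∈ₗ-filter⁻; ∈-map⁻ to ∈ₗ-map⁻)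
open import Data.Nat.Base hiding (_/_)
open import Data.Nat.Properties
open import Data.Nat.Tactic.RingSolver using (solve-∀)
open import Data.Product.Base using (∃-syntax; _×_; _,_; proj₁; proj₂)
open import Data.Sum.Base using (inj₁; inj₂)
open import Data.Unit.Base using (⊤; tt)
open import Data.Vec.Base as Vec using ([]; _∷_; lookup)
open import Data.Vec.Membership.Propositional using (_∈_)
open import Data.Vec.Relation.Binary.Pointwise.Inductive using (Pointwise; []; _∷_)
open import Data.Vec.Relation.Unary.All as All using ([]; _∷_)
open import Data.Vec.Relation.Unary.AllPairs as AllPairs using ([]; _∷_)
open import Data.Vec.Relation.Unary.Any using (here; there)
import Data.Vec.Relation.Unary.All.Properties as All
import Data.Vec.Relation.Unary.AllPairs.Properties as AllPairs
open import Function.Base using (_∘_; id)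
open import Relation.Binary.PropositionalEquality
open import Relation.Nullary using (¬_; yes; no)
open import Relation.Unary using (Decidable)
open import Algebra.Properties.Semiring.Sum +-*-semiring
  using (sum; sum-syntax; sum-cong-≗; ∑-distrib-+; ∑-comm; *-distribˡ-sum)

private
  variable
    d k m n q : ℕ
    ks : Vec ℕ d

-- Power sums: the Chebyshev and power mean inequalities.

^-distribʳ-* : ∀ k m n → (m * n) ^ k ≡ m ^ k * n ^ k
^-distribʳ-* zero    m n = refl
^-distribʳ-* (suc k) m n =
  trans (cong (m * n *_) (^-distribʳ-* k m n)) ([m*n]*[o*p]≡[m*o]*[n*p] m n (m ^ k) (n ^ k))

∑-mono-≤ : {g h : Fin n → ℕ} → (∀ i → g i ≤ h i) → sum g ≤ sum h
∑-mono-≤ {zero}  g≤h = z≤n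
∑-mono-≤ {suc n} g≤h = +-mono-≤ (g≤h Fin.zero) (∑-mono-≤ (g≤h ∘ Fin.suc))

∑-const : ∀ n x → ∑[ i < n ] x ≡ n * x
∑-const zero    x = refl
∑-const (suc n) x = cong (_+_ x) (∑-const n x)

-- With `y = x + d` and `y ^ k = x ^ k + e`, the two sides differ by exactly `d * e`.
rearrangement-ordered : ∀ k {x y} → x ≤ y → x * y ^ k + y * x ^ k ≤ x ^ suc k + y ^ suc k
rearrangement-ordered k {x} {y} x≤y
  with d , refl ← m≤n⇒∃[o]m+o≡n x≤y
  with e , xᵏ+e≡yᵏ ← m≤n⇒∃[o]m+o≡n (^-monoˡ-≤ k x≤y)
  rewrite sym xᵏ+e≡yᵏ = begin
    x * (x ^ k + e) + (x + d) * x ^ k          ≤⟨ m≤m+n _ (d * e) ⟩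
    x * (x ^ k + e) + (x + d) * x ^ k + d * e  ≡⟨ expand x (x ^ k) d e ⟩
    x * x ^ k + (x + d) * (x ^ k + e)          ∎
  where
  open ≤-Reasoning
  expand : ∀ x u d e → x * (u + e) + (x + d) * u + d * e ≡ x * u + (x + d) * (u + e)
  expand = solve-∀

rearrangement : ∀ k x y → x * y ^ k + y * x ^ k ≤ x ^ suc k + y ^ suc k
rearrangement k x y with ≤-total x y
... | inj₁ x≤y = rearrangement-ordered k x≤y
... | inj₂ y≤x = subst₂ _≤_ (+-comm (y * x ^ k) _) (+-comm (y ^ suc k) _) (rearrangement-ordered k y≤x)

-- Chebyshev's sum inequality for the similarly ordered sequences `g` and `g ^ k`. Peeling off the
-- first term leaves one pair of cross terms for each remaining index, and `rearrangement` bounds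
-- it.
chebyshev : ∀ k (g : Fin n → ℕ) →
            sum g * ∑[ i < n ] (g i ^ k) ≤ n * ∑[ i < n ] (g i ^ suc k)
chebyshev {zero}  k g = z≤n
chebyshev {suc n} k g = begin
  (x + X) * (x ^ k + Y)                          ≡⟨ expand x X (x ^ k) Y ⟩
  x * x ^ k + (x * Y + x ^ k * X) + X * Y        ≤⟨ +-mono-≤ (+-monoʳ-≤ (x ^ suc k) cross) (chebyshev k (g ∘ Fin.suc)) ⟩
  x ^ suc k + (n * x ^ suc k + Z) + n * Z        ≡⟨ collect n (x ^ suc k) Z ⟩
  suc n * (x ^ suc k + Z)                        ∎
  where
  open ≤-Reasoning
  x = g Fin.zero
  X = ∑[ i < n ] g (Fin.suc i)
  Y = ∑[ i < n ] (g (Fin.suc i) ^ k)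
  Z = ∑[ i < n ] (g (Fin.suc i) ^ suc k)
  expand : ∀ x X u Y → (x + X) * (u + Y) ≡ x * u + (x * Y + u * X) + X * Y
  expand = solve-∀
  collect : ∀ n u Z → u + (n * u + Z) + n * Z ≡ suc n * (u + Z)
  collect = solve-∀
  cross : x * Y + x ^ k * X ≤ n * x ^ suc k + Z
  cross = begin
    x * Y + x ^ k * X
      ≡⟨ cong₂ _+_ (*-distribˡ-sum {n} x _) (*-distribˡ-sum {n} (x ^ k) _) ⟩
    ∑[ i < n ] (x * g (Fin.suc i) ^ k) + ∑[ i < n ] (x ^ k * g (Fin.suc i))
      ≡⟨ ∑-distrib-+ {n} _ _ ⟨
    ∑[ i < n ] (x * g (Fin.suc i) ^ k + x ^ k * g (Fin.suc i))
      ≤⟨ ∑-mono-≤ (λ i → subst (_≤ x ^ suc k + g (Fin.suc i) ^ suc k)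
           (cong (_+_ (x * g (Fin.suc i) ^ k)) (*-comm (g (Fin.suc i)) _))
                                (rearrangement k x (g (Fin.suc i)))) ⟩
    ∑[ i < n ] (x ^ suc k + g (Fin.suc i) ^ suc k)
      ≡⟨ ∑-distrib-+ {n} _ _ ⟩
    ∑[ i < n ] (x ^ suc k) + Z
      ≡⟨ cong (_+ Z) (∑-const n _) ⟩
    n * x ^ suc k + Z ∎

-- Each use of `chebyshev` raises the exponent under the sum by one, trading a factor `sum g` for a
-- factor `n`.
power-mean : ∀ k (g : Fin n → ℕ) → sum g ^ suc k ≤ n ^ k * ∑[ i < n ] (g i ^ suc k)
power-mean {n} zero    g = ≤-reflexive (begin
  sum g * 1                    ≡⟨ *-comm (sum g) 1 ⟩
  1 * sum g                    ≡⟨ cong (1 *_) (sum-cong-≗ λ i → *-identityʳ (g i)) ⟨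
  1 * ∑[ i < n ] (g i * 1)     ∎)
  where open ≡-Reasoning
power-mean {n} (suc k) g = begin
  sum g * sum g ^ suc k                          ≤⟨ *-monoʳ-≤ (sum g) (power-mean k g) ⟩
  sum g * (n ^ k * ∑[ i < n ] (g i ^ suc k))     ≡⟨ swap (sum g) (n ^ k) _ ⟩
  n ^ k * (sum g * ∑[ i < n ] (g i ^ suc k))     ≤⟨ *-monoʳ-≤ (n ^ k) (chebyshev (suc k) g) ⟩
  n ^ k * (n * ∑[ i < n ] (g i ^ suc (suc k)))   ≡⟨ swap (n ^ k) n _ ⟩
  n * (n ^ k * ∑[ i < n ] (g i ^ suc (suc k)))   ≡⟨ *-assoc n (n ^ k) _ ⟨
  n ^ suc k * ∑[ i < n ] (g i ^ suc (suc k))     ∎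
  where
  open ≤-Reasoning
  swap : ∀ x y z → x * (y * z) ≡ y * (x * z)
  swap = solve-∀

-- Sums over the positions of a cube.

gridSum : ∀ d → (Vec (Fin n) d → ℕ) → ℕ
gridSum zero    g = g []
gridSum (suc d) g = sum λ i → gridSum d λ v → g (i ∷ v)

gridSum-mono-≤ : ∀ d {g h : Vec (Fin n) d → ℕ} → (∀ v → g v ≤ h v) → gridSum d g ≤ gridSum d h
gridSum-mono-≤ zero    g≤h = g≤h []
gridSum-mono-≤ (suc d) g≤h = ∑-mono-≤ λ i → gridSum-mono-≤ d λ v → g≤h (i ∷ v)

gridSum-cong : ∀ d {g h : Vec (Fin n) d → ℕ} → (∀ v → g v ≡ h v) → gridSum d g ≡ gridSum d h
gridSum-cong zero    g≡h = g≡h []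
gridSum-cong (suc d) g≡h = sum-cong-≗ λ i → gridSum-cong d λ v → g≡h (i ∷ v)

gridSum-distrib-+ : ∀ d (g h : Vec (Fin n) d → ℕ) →
                    gridSum d (λ v → g v + h v) ≡ gridSum d g + gridSum d h
gridSum-distrib-+         zero    g h = refl
gridSum-distrib-+ {n = n} (suc d) g h =
  trans (sum-cong-≗ {n} λ i → gridSum-distrib-+ d (λ v → g (i ∷ v)) λ v → h (i ∷ v)) (∑-distrib-+ {n} _ _)

*-distribˡ-gridSum : ∀ d x (g : Vec (Fin n) d → ℕ) →
                     x * gridSum d g ≡ gridSum d (λ v → x * g v)
*-distribˡ-gridSum         zero    x g = refl
*-distribˡ-gridSum {n = n} (suc d) x g =
  trans (*-distribˡ-sum {n} x _) (sum-cong-≗ {n} λ i → *-distribˡ-gridSum d x λ v → g (i ∷ v))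

gridSum-const : ∀ d x → gridSum {n} d (λ _ → x) ≡ n ^ d * x
gridSum-const         zero    x = sym (+-identityʳ x)
gridSum-const {n = n} (suc d) x = begin
  ∑[ i < n ] gridSum {n} d (λ _ → x)  ≡⟨ ∑-const n _ ⟩
  n * gridSum {n} d (λ _ → x)         ≡⟨ cong (n *_) (gridSum-const d x) ⟩
  n * (n ^ d * x)                     ≡⟨ *-assoc n (n ^ d) x ⟨
  n ^ suc d * x                       ∎
  where open ≡-Reasoning

∑-gridSum-comm : ∀ d (g : Fin m → Vec (Fin n) d → ℕ) →
                 ∑[ i < m ] gridSum d (g i) ≡ gridSum d (λ v → ∑[ i < m ] g i v)
∑-gridSum-comm                 zero    g = refl
∑-gridSum-comm {m = m} {n = n} (suc d) g =
  trans (∑-comm {m} {n} _) (sum-cong-≗ λ j → ∑-gridSum-comm d λ i v → g i (j ∷ v))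

gridSum-power-mean : ∀ d k (g : Vec (Fin n) d → ℕ) →
                     gridSum d g ^ suc k ≤ (n ^ d) ^ k * gridSum d (λ v → g v ^ suc k)
gridSum-power-mean zero k g = ≤-reflexive (begin
  g [] ^ suc k          ≡⟨ *-identityˡ _ ⟨
  1 * g [] ^ suc k      ≡⟨ cong (_* g [] ^ suc k) (^-zeroˡ k) ⟨
  1 ^ k * g [] ^ suc k  ∎)
  where open ≡-Reasoning
gridSum-power-mean {n = n} (suc d) k g = begin
  gridSum (suc d) g ^ suc k
    ≤⟨ power-mean k (λ i → gridSum d (λ v → g (i ∷ v))) ⟩
  n ^ k * ∑[ i < n ] (gridSum d (λ v → g (i ∷ v)) ^ suc k)
    ≤⟨ *-monoʳ-≤ (n ^ k) (∑-mono-≤ λ i → gridSum-power-mean d k (λ v → g (i ∷ v))) ⟩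
  n ^ k * ∑[ i < n ] ((n ^ d) ^ k * gridSum d (λ v → g (i ∷ v) ^ suc k))
    ≡⟨ cong (n ^ k *_) (*-distribˡ-sum {n} ((n ^ d) ^ k) _) ⟨
  n ^ k * ((n ^ d) ^ k * gridSum (suc d) (λ v → g v ^ suc k))
    ≡⟨ *-assoc (n ^ k) _ _ ⟨
  n ^ k * (n ^ d) ^ k * gridSum (suc d) (λ v → g v ^ suc k)
    ≡⟨ cong (_* gridSum (suc d) (λ v → g v ^ suc k)) (^-distribʳ-* k n (n ^ d)) ⟨
  (n ^ suc d) ^ k * gridSum (suc d) (λ v → g v ^ suc k) ∎
  where open ≤-Reasoning

-- Conjunctions of layers and moments of column counts.

bit : Bool → ℕ
bit true  = 1
bit false = 0

bit-∧ : ∀ b c → bit (b ∧ c) ≡ bit b * bit c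
bit-∧ true  c = sym (*-identityˡ (bit c))
bit-∧ false c = refl

meet : (Fin m → Vec (Fin n) d → Bool) → Vec (Fin m) k → Vec (Fin n) d → Bool
meet a []       v = true
meet a (i ∷ is) v = a i v ∧ meet a is v

meet-map : ∀ {l} (a : Fin m → Vec (Fin n) d → Bool) (g : Fin l → Fin m) (is : Vec (Fin l) k) v →
           meet a (Vec.map g is) v ≡ meet (a ∘ g) is v
meet-map a g []       v = refl
meet-map a g (i ∷ is) v = cong (a (g i) v ∧_) (meet-map a g is v)

meet-∈ : (a : Fin m → Vec (Fin n) d → Bool) {is : Vec (Fin m) k} {i : Fin m} → ∀ v →
         meet a is v ≡ true → i ∈ is → a i v ≡ true
meet-∈ a {i ∷ is} v t (here refl) = ∧-conicalˡ _ _ t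
meet-∈ a {i ∷ is} v t (there i∈)  = meet-∈ a v (∧-conicalʳ (a i v) _ t) i∈

-- `shift` and `extend` give the choices that omit layer zero and those that contain it, as in
-- Pascal's rule.
shift : Choice m k → Choice (suc m) k
shift (is , is<) = Vec.map Fin.suc is , AllPairs.map⁺ (AllPairs.map s≤s is<)

extend : Choice m k → Choice (suc m) (suc k)
extend (is , is<) =
  Fin.zero ∷ Vec.map Fin.suc is , All.map⁺ (All.universal (λ _ → z<s) is) ∷ proj₂ (shift (is , is<))

suc-^-≤ : ∀ k x → suc x ^ suc k ≤ x ^ suc k + suc k * suc x ^ k
suc-^-≤ zero    x = ≤-reflexive (base x)
  where
  base : ∀ x → suc x * 1 ≡ x * 1 + 1
  base = solve-∀
suc-^-≤ (suc k) x = begin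
  suc x * suc x ^ suc k                               ≤⟨ *-monoʳ-≤ (suc x) (suc-^-≤ k x) ⟩
  suc x * (x ^ suc k + suc k * suc x ^ k)             ≡⟨ expand x (x ^ suc k) k (suc x ^ k) ⟩
  x * x ^ suc k + (x ^ suc k + suc k * suc x ^ suc k)
    ≤⟨ +-monoʳ-≤ (x ^ suc (suc k)) (+-monoˡ-≤ (suc k * suc x ^ suc k) (^-monoˡ-≤ (suc k) (n≤1+n x))) ⟩
  x ^ suc (suc k) + suc (suc k) * suc x ^ suc k       ∎
  where
  open ≤-Reasoning
  expand : ∀ x u k w → suc x * (u + suc k * w) ≡ x * u + (u + suc k * (suc x * w))
  expand = solve-∀

-- The analogue of `(c + 1)_(k + 1) = (c)_(k + 1) + (k + 1) (c)_k` for falling factorials, with `(c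
-- ∸ k) ^ k` in place of `(c)_k`. For `c ≤ k` the left side vanishes; otherwise this is the mean
-- value bound.
∸-^-suc : ∀ k c → (c ∸ k) ^ suc k ≤ (c ∸ suc k) ^ suc k + suc k * (c ∸ k) ^ k
∸-^-suc k c with c ∸ k in eq
... | zero  = z≤n
... | suc x = subst (λ y → suc x ^ suc k ≤ y ^ suc k + suc k * suc x ^ k) (sym c∸1+k≡x) (suc-^-≤ k x)
  where
  c∸1+k≡x : c ∸ suc k ≡ x
  c∸1+k≡x = trans (sym (pred[m∸n]≡m∸[1+n] c k)) (cong pred eq)

bit-pascal : ∀ k b c →
             (bit b + c ∸ suc k) ^ suc k ≤ (c ∸ suc k) ^ suc k + bit b * (suc k * (c ∸ k) ^ k)
bit-pascal k false c = m≤m+n _ 0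
bit-pascal k true  c = subst (λ y → (c ∸ k) ^ suc k ≤ (c ∸ suc k) ^ suc k + y) (sym (*-identityˡ _)) (∸-^-suc k c)

-- (c ∸ k) ^ k ≤ c (c - 1) ⋯ (c - k + 1) stands in for k! times the number of
-- k-subsets of the c layers through v; the induction is on the first layer.
column-moment : ∀ m k (a : Fin m → Vec (Fin n) d → Bool) (w : Vec (Fin n) d → ℕ) B →
                (∀ (c : Choice m k) → gridSum d (λ v → w v * bit (meet a (proj₁ c) v)) ≤ B) →
                gridSum d (λ v → w v * (∑[ i < m ] bit (a i v) ∸ k) ^ k) ≤ k ! * (m ^ k * B)
-- With no layer chosen the conjunction is `true`, so the hypothesis at the empty choice bounds the
-- total of `w` itself.
column-moment m       zero    a w B H = subst (_ ≤_) (sym (trans (*-identityˡ _) (*-identityˡ B))) (H ([] , []))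
column-moment {n} {d} zero (suc k) a w B H = ≤-trans
  (≤-reflexive (trans (gridSum-cong d λ v → *-zeroʳ (w v)) (trans (gridSum-const {n} d 0) (*-zeroʳ (n ^ d))))) z≤n
column-moment {n} {d} (suc m) (suc k) a w B H = begin
  gridSum d (λ v → w v * (bit (a₀ v) + c v ∸ suc k) ^ suc k)
    ≤⟨ gridSum-mono-≤ d (λ v → *-monoʳ-≤ (w v) (bit-pascal k (a₀ v) (c v))) ⟩
  gridSum d (λ v → w v * ((c v ∸ suc k) ^ suc k + bit (a₀ v) * (suc k * (c v ∸ k) ^ k)))
    ≡⟨ gridSum-cong d (λ v → expand (w v) _ (bit (a₀ v)) k _) ⟩
  gridSum d (λ v → w v * (c v ∸ suc k) ^ suc k + suc k * (w v * bit (a₀ v) * (c v ∸ k) ^ k))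
    ≡⟨ gridSum-distrib-+ d _ _ ⟩
  gridSum d (λ v → w v * (c v ∸ suc k) ^ suc k) + gridSum d (λ v → suc k * (w v * bit (a₀ v) * (c v ∸ k) ^ k))
    ≡⟨ cong (_+_ _) (*-distribˡ-gridSum d (suc k) _) ⟨
  gridSum d (λ v → w v * (c v ∸ suc k) ^ suc k) + suc k * gridSum d (λ v → w v * bit (a₀ v) * (c v ∸ k) ^ k)
    -- Layer zero is either left out or used. In the second case its indicator is absorbed into the
    -- weight, which is why `w` is arbitrary.
    ≤⟨ +-mono-≤ (column-moment m (suc k) (a ∘ Fin.suc) w B H-shift)
                (*-monoʳ-≤ (suc k) (column-moment m k (a ∘ Fin.suc) (λ v → w v * bit (a₀ v)) B H-extend)) ⟩
  suc k ! * (m ^ suc k * B) + suc k * (k ! * (m ^ k * B))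
    ≡⟨ collect k (k !) m (m ^ k) B ⟩
  suc k ! * (suc m * m ^ k * B)
    ≤⟨ *-monoʳ-≤ (suc k !) (*-monoˡ-≤ B (*-monoʳ-≤ (suc m) (^-monoˡ-≤ k (n≤1+n m)))) ⟩
  suc k ! * (suc m ^ suc k * B) ∎
  where
  open ≤-Reasoning
  a₀ = a Fin.zero
  c = λ v → ∑[ i < m ] bit (a (Fin.suc i) v)
  expand : ∀ w x b k y → w * (x + b * (suc k * y)) ≡ w * x + suc k * (w * b * y)
  expand = solve-∀
  collect : ∀ k f m p B → suc k * f * (m * p * B) + suc k * (f * (p * B)) ≡ suc k * f * (suc m * p * B)
  collect = solve-∀
  H-shift : ∀ c → gridSum d (λ v → w v * bit (meet (a ∘ Fin.suc) (proj₁ c) v)) ≤ B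
  H-shift c = subst (_≤ B)
    (gridSum-cong d λ v → cong (λ b → w v * bit b) (meet-map a Fin.suc (proj₁ c) v)) (H (shift c))
  H-extend : ∀ c → gridSum d (λ v → w v * bit (a₀ v) * bit (meet (a ∘ Fin.suc) (proj₁ c) v)) ≤ B
  H-extend c = subst (_≤ B)
    (gridSum-cong d λ v → begin-equality
      w v * bit (a₀ v ∧ meet a (Vec.map Fin.suc (proj₁ c)) v)
        ≡⟨ cong (λ b → w v * bit (a₀ v ∧ b)) (meet-map a Fin.suc (proj₁ c) v) ⟩
      w v * bit (a₀ v ∧ meet (a ∘ Fin.suc) (proj₁ c) v)
        ≡⟨ cong (w v *_) (bit-∧ (a₀ v) _) ⟩
      w v * (bit (a₀ v) * bit (meet (a ∘ Fin.suc) (proj₁ c) v))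
        ≡⟨ *-assoc (w v) _ _ ⟨
      w v * bit (a₀ v) * bit (meet (a ∘ Fin.suc) (proj₁ c) v) ∎)
    (H (extend c))

-- Boolean arrays, avoidance and the number of ones.

_∈ₛ_ : Vec (Fin n) d → Selection (cube d n) ks → Set
[]      ∈ₛ []             = ⊤
(i ∷ v) ∈ₛ ((is , _) ∷ σ) = i ∈ is × v ∈ₛ σ

-- Avoidance of `R ks` for an array read as a function of the position.
Clear : (ks : Vec ℕ d) → (Vec (Fin n) d → Bool) → Set
Clear {d} {n} ks a = (σ : Selection (cube d n) ks) → ¬ (∀ v → v ∈ₛ σ → a v ≡ true)

weight : (Vec (Fin n) d → Bool) → ℕ
weight {d = d} a = gridSum d (bit ∘ a)

layers : (Vec (Fin n) (suc d) → Bool) → Fin n → Vec (Fin n) d → Bool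
layers a i v = a (i ∷ v)

-- A box full of ones in the conjunction, multiplied by the chosen layers, is a full box of `a`.
clear-meet : {a : Vec (Fin n) (suc d) → Bool} → Clear (k ∷ ks) a →
             (c : Choice n k) → Clear ks (meet (layers a) (proj₁ c))
clear-meet {a = a} clear c σ full =
  clear (c ∷ σ) λ { (i ∷ v) (i∈ , v∈) → meet-∈ (layers a) v (full v v∈) i∈ }

-- The subtraction is truncated; the at most `k` ones removed from each column are restored by
-- `k * n ^ d` in `weight≤excess`.
excess : ℕ → (Vec (Fin n) (suc d) → Bool) → Vec (Fin n) d → ℕ
excess {n} k a v = ∑[ i < n ] bit (a (i ∷ v)) ∸ k

weight≤excess : ∀ k (a : Vec (Fin n) (suc d) → Bool) →
                weight a ≤ k * n ^ d + gridSum d (excess k a)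
weight≤excess {n} {d} k a = begin
  ∑[ i < n ] gridSum d (λ v → bit (a (i ∷ v)))
    ≡⟨ ∑-gridSum-comm d (λ i v → bit (a (i ∷ v))) ⟩
  gridSum d (λ v → ∑[ i < n ] bit (a (i ∷ v)))
    ≤⟨ gridSum-mono-≤ d (λ v → m≤n+m∸n _ k) ⟩
  gridSum d (λ v → k + excess k a v)
    ≡⟨ gridSum-distrib-+ d _ _ ⟩
  gridSum {n} d (λ _ → k) + gridSum d (excess k a)
    ≡⟨ cong (_+ gridSum d (excess k a)) (trans (gridSum-const d k) (*-comm (n ^ d) k)) ⟩
  k * n ^ d + gridSum d (excess k a) ∎
  where open ≤-Reasoning

excess-moment : ∀ k (a : Vec (Fin n) (suc d) → Bool) B →
                (∀ (c : Choice n k) → weight (meet (layers a) (proj₁ c)) ≤ B) →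
                gridSum d (λ v → excess k a v ^ k) ≤ k ! * (n ^ k * B)
excess-moment {n} {d} k a B H = subst (_≤ k ! * (n ^ k * B))
  (gridSum-cong d λ v → *-identityˡ _)
  (column-moment n k (layers a) (λ _ → 1) B λ c →
    subst (_≤ B) (gridSum-cong d λ v → sym (*-identityˡ _)) (H c))

-- Integer roots and the form of the bound.

maximal : {P : ℕ → Set} → Decidable P → P 0 → ∀ m → ∃[ B ] (P B × (∀ {x} → x ≤ m → P x → x ≤ B))
maximal P? P0 zero    = 0 , P0 , λ x≤0 _ → x≤0
maximal {P} P? P0 (suc m) with P? (suc m)
... | yes Pm = suc m , Pm , λ x≤m _ → x≤m
... | no ¬Pm with B , PB , B-max ← maximal P? P0 m =
  B , PB , λ {x} x≤1+m Px → B-max (s≤s⁻¹ (≤∧≢⇒< x≤1+m λ { refl → ¬Pm Px })) Px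

-- `B` is the integer part of `(X / n) ^ (1 / q)`. It turns a bound on `q`th powers into one integer
-- bound for all conjunctions at once, which can later be raised to the power `q` again.
root : ∀ q n X .{{_ : NonZero q}} .{{_ : NonZero n}} →
       ∃[ B ] (B ^ q * n ≤ X × (∀ x → x ^ q * n ≤ X → x ≤ B))
root (suc q) n X
  with B , le , B-max ← maximal (λ x → x ^ suc q * n ≤? X) z≤n X
  -- Every solution satisfies `x ≤ x ^ suc q * n ≤ X`, so a search up to `X` misses none.
  = B , le , λ x x≤ → B-max (≤-trans (≤-trans (m≤m^1+q x) (m≤m*n _ n)) x≤) x≤
  where
  m≤m^1+q : ∀ x → x ≤ x ^ suc q
  m≤m^1+q zero    = z≤n
  m≤m^1+q (suc x) = m≤m*n (suc x) (suc x ^ q) {{m^n≢0 (suc x) q}}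

-- The sum is at most twice the larger term.
[m+n]^k≤2^k*[m^k+n^k] : ∀ m n k → (m + n) ^ k ≤ 2 ^ k * (m ^ k + n ^ k)
[m+n]^k≤2^k*[m^k+n^k] m n k with ≤-total m n
... | inj₁ m≤n = begin
  (m + n) ^ k                ≤⟨ ^-monoˡ-≤ k (+-mono-≤ m≤n (≤-reflexive (sym (+-identityʳ n)))) ⟩
  (2 * n) ^ k                ≡⟨ ^-distribʳ-* k 2 n ⟩
  2 ^ k * n ^ k              ≤⟨ *-monoʳ-≤ (2 ^ k) (m≤n+m (n ^ k) (m ^ k)) ⟩
  2 ^ k * (m ^ k + n ^ k)    ∎
  where open ≤-Reasoning
... | inj₂ n≤m = begin
  (m + n) ^ k                ≤⟨ ^-monoˡ-≤ k (+-monoʳ-≤ m (≤-trans n≤m (≤-reflexive (sym (+-identityʳ m))))) ⟩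
  (2 * m) ^ k                ≡⟨ ^-distribʳ-* k 2 m ⟩
  2 ^ k * m ^ k              ≤⟨ *-monoʳ-≤ (2 ^ k) (m≤m+n (m ^ k) (n ^ k)) ⟩
  2 ^ k * (m ^ k + n ^ k)    ∎
  where open ≤-Reasoning

-- The number of ones is O(n ^ (d - 1 / q)), uniformly in the array.
Bound : (ks : Vec ℕ d) → ℕ → Set
Bound {d} ks q = ∃[ C ] (∀ n .{{_ : NonZero n}} (a : Vec (Fin n) d → Bool) → Clear ks a →
                          weight a ^ q * n ≤ C * (n ^ d) ^ q)

-- Induction over the coordinates.

-- The conjunction of any `k` layers is a single entry, and it is `false` because `a` is clear. So
-- `B = 0` serves in the moment estimate, the excess vanishes and `a` has at most `k` ones.
bound-singleton : ∀ k → Bound (k ∷ []) 1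
bound-singleton k = k , λ n a clear →
  let H : ∀ (c : Choice n k) → weight (meet (layers a) (proj₁ c)) ≤ 0
      H c = ≤-reflexive (cong bit (¬-not (λ t → clear-meet clear c [] λ { [] _ → t })))
      no-excess : excess k a [] ^ k ≡ 0
      no-excess = n≤0⇒n≡0 (subst (excess k a [] ^ k ≤_)
        (trans (cong (k ! *_) (*-zeroʳ (n ^ k))) (*-zeroʳ (k !))) (excess-moment k a 0 H))
      weight≤k : weight a ≤ k
      weight≤k = subst (weight a ≤_)
        (trans (cong (_+_ (k * 1)) (m^n≡0⇒m≡0 _ k no-excess)) (trans (+-identityʳ _) (*-identityʳ k)))
        (weight≤excess k a)
  in *-mono-≤ (subst (_≤ k) (sym (*-identityʳ _)) weight≤k)
       (≤-reflexive (sym (trans (*-identityʳ (n ^ 1)) (*-identityʳ n))))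

-- Up to constants `X ^ k` is at most `N ^ (k - 1) * n ^ k * B` with `B` of order `n ^ (d - 1 / q)`,
-- hence `X` has order `n ^ (d + 1 - 1 / (k * q))`. Working with `r`th powers, `r = k * q`, keeps
-- all exponents integral.
bound-∷ : ∀ k .{{_ : NonZero k}} .{{_ : NonZero q}} → Bound ks q → Bound (k ∷ ks) (k * q)
-- The factor `2 ^ r` comes from splitting `k * N + X`, the term `k ^ r` from the first summand and
-- `(k !) ^ q * C` from the excess.
bound-∷ {q} {d} {ks} k@(suc k-1) (C , bound) = 2 ^ r * (k ^ r + (k !) ^ q * C) , λ n a clear →
  let
    open ≤-Reasoning
    N = n ^ d
    T = weight a
    X = gridSum d (excess k a)
    B , B^q*n≤ , B-max = root q n (C * N ^ q)

    X^k≤ : X ^ k ≤ N ^ k-1 * (k ! * (n ^ k * B))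
    X^k≤ = ≤-trans (gridSum-power-mean d k-1 (excess k a))
      (*-monoʳ-≤ (N ^ k-1) (excess-moment k a B λ c → B-max _ (bound n _ (clear-meet clear c))))

    X^r*n≤ : X ^ r * n ≤ (k !) ^ q * C * (n ^ suc d) ^ r
    X^r*n≤ = begin
      X ^ r * n
        ≡⟨ cong (_* n) (^-*-assoc X k q) ⟨
      (X ^ k) ^ q * n
        ≤⟨ *-monoˡ-≤ n (^-monoˡ-≤ q X^k≤) ⟩
      (N ^ k-1 * (k ! * (n ^ k * B))) ^ q * n
        ≡⟨ cong (_* n) (^-distribʳ-*₄ q (N ^ k-1) (k !) (n ^ k) B) ⟩
      (N ^ k-1) ^ q * ((k !) ^ q * ((n ^ k) ^ q * B ^ q)) * n
        ≡⟨ assoc ((N ^ k-1) ^ q) ((k !) ^ q) ((n ^ k) ^ q) (B ^ q) n ⟩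
      (N ^ k-1) ^ q * ((k !) ^ q * ((n ^ k) ^ q * (B ^ q * n)))
        -- The factor `n` was carried along to meet `B ^ q` here, since `root` controls their
        -- product.
        ≤⟨ *-monoʳ-≤ ((N ^ k-1) ^ q) (*-monoʳ-≤ ((k !) ^ q) (*-monoʳ-≤ ((n ^ k) ^ q) B^q*n≤)) ⟩
      (N ^ k-1) ^ q * ((k !) ^ q * ((n ^ k) ^ q * (C * N ^ q)))
        ≡⟨ collect ((N ^ k-1) ^ q) ((k !) ^ q) ((n ^ k) ^ q) C (N ^ q) ⟩
      (k !) ^ q * C * ((n ^ k) ^ q * (N ^ q * (N ^ k-1) ^ q))
        ≡⟨ cong (λ z → (k !) ^ q * C * ((n ^ k) ^ q * z)) (^-distribʳ-* q N (N ^ k-1)) ⟨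
      (k !) ^ q * C * ((n ^ k) ^ q * (N ^ k) ^ q)
        ≡⟨ cong ((k !) ^ q * C *_) (cong₂ _*_ (^-*-assoc n k q) (^-*-assoc N k q)) ⟩
      (k !) ^ q * C * (n ^ r * N ^ r)
        ≡⟨ cong ((k !) ^ q * C *_) (^-distribʳ-* r n N) ⟨
      (k !) ^ q * C * (n ^ suc d) ^ r ∎

    [kN]^r*n≤ : (k * N) ^ r * n ≤ k ^ r * (n ^ suc d) ^ r
    [kN]^r*n≤ = begin
      (k * N) ^ r * n          ≡⟨ cong (_* n) (^-distribʳ-* r k N) ⟩
      -- As `r` is positive, the summand `k * N`, of order `n ^ d`, has room for the extra factor
      -- `n`.
      k ^ r * N ^ r * n        ≤⟨ *-monoʳ-≤ (k ^ r * N ^ r) (n≤n^r n) ⟩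
      k ^ r * N ^ r * n ^ r    ≡⟨ swap (k ^ r) (N ^ r) (n ^ r) ⟩
      k ^ r * (n ^ r * N ^ r)  ≡⟨ cong (k ^ r *_) (^-distribʳ-* r n N) ⟨
      k ^ r * (n ^ suc d) ^ r  ∎
  in begin
    T ^ r * n
      ≤⟨ *-monoˡ-≤ n (^-monoˡ-≤ r (weight≤excess k a)) ⟩
    (k * N + X) ^ r * n
      ≤⟨ *-monoˡ-≤ n ([m+n]^k≤2^k*[m^k+n^k] (k * N) X r) ⟩
    2 ^ r * ((k * N) ^ r + X ^ r) * n
      ≡⟨ distrib (2 ^ r) ((k * N) ^ r) (X ^ r) n ⟩
    2 ^ r * ((k * N) ^ r * n + X ^ r * n)
      ≤⟨ *-monoʳ-≤ (2 ^ r) (+-mono-≤ [kN]^r*n≤ X^r*n≤) ⟩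
    2 ^ r * (k ^ r * (n ^ suc d) ^ r + (k !) ^ q * C * (n ^ suc d) ^ r)
      ≡⟨ distrib (2 ^ r) (k ^ r) ((k !) ^ q * C) _ ⟨
    2 ^ r * (k ^ r + (k !) ^ q * C) * (n ^ suc d) ^ r ∎
  where
  r = k * q
  n≤n^r : ∀ n .{{_ : NonZero n}} → n ≤ n ^ r
  n≤n^r n = subst (_≤ n ^ r) (^-identityʳ n) (^-monoʳ-≤ n (>-nonZero⁻¹ r {{m*n≢0 k q}}))
  ^-distribʳ-*₄ : ∀ q w x y z → (w * (x * (y * z))) ^ q ≡ w ^ q * (x ^ q * (y ^ q * z ^ q))
  ^-distribʳ-*₄ q w x y z = trans (^-distribʳ-* q w _) (cong (w ^ q *_)
    (trans (^-distribʳ-* q x _) (cong (x ^ q *_) (^-distribʳ-* q y z))))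
  assoc : ∀ a b c d e → a * (b * (c * d)) * e ≡ a * (b * (c * (d * e)))
  assoc = solve-∀
  collect : ∀ a b c d e → a * (b * (c * (d * e))) ≡ b * d * (c * (e * a))
  collect = solve-∀
  swap : ∀ a b c → a * b * c ≡ a * (c * b)
  swap = solve-∀
  distrib : ∀ a b c d → a * (b + c) * d ≡ a * (b * d + c * d)
  distrib = solve-∀

-- Exchanging two coordinates only reorders the sum of ones. Since `bound-∷` adds a side in front,
-- this restores the distinguished side to the head in `bound-product`.
bound-swap : ∀ {k l} → Bound (k ∷ l ∷ ks) q → Bound (l ∷ k ∷ ks) q
bound-swap {d} {ks} {q} (C , bound) = C , λ n a clear →
  subst (λ T → T ^ q * n ≤ C * (n ^ suc (suc d)) ^ q)
    (∑-comm {n} {n} λ i j → gridSum d λ v → bit (a (j ∷ i ∷ v)))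
    (bound n (a ∘ transpose) λ { (c ∷ c′ ∷ σ) full →
      clear (c′ ∷ c ∷ σ) λ { (i ∷ j ∷ v) (i∈ , j∈ , v∈) → full (j ∷ i ∷ v) (j∈ , i∈ , v∈) } })
  where
  transpose : Vec (Fin n) (suc (suc d)) → Vec (Fin n) (suc (suc d))
  transpose (i ∷ j ∷ v) = j ∷ i ∷ v

-- The head `k` is the coordinate `j` left over in dimension one; each other side is added in turn
-- and multiplies `q`.
bound-product : ∀ k → All NonZero ks → Bound (k ∷ ks) (product ks)
bound-product               k []           = bound-singleton k
bound-product {ks = l ∷ ls} k (l≢0 ∷ ls≢0) = bound-swap {q = l * product ls}
  (bound-∷ l {{l≢0}} {{product≢0 ls≢0}} (bound-product k ls≢0))

-- Here `q` is the reciprocal of `α`. The recursion looks for a largest side: a head at least as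
-- large as the rest becomes `j`, any other head is peeled off and multiplies `q`.
bound-max : ∀ {k} → All NonZero (k ∷ ks) →
            ∃[ q ] (Bound (k ∷ ks) q × product (k ∷ ks) ≡ maximum (k ∷ ks) * q)
bound-max {ks = []}     {k} (k≢0 ∷ []) = 1 , bound-singleton k , cong (_* 1) (sym (⊔-identityʳ k))
bound-max {ks = l ∷ ks} {k} (k≢0 ∷ ks≢0) with ≤-total (maximum (l ∷ ks)) k
... | inj₁ max≤k = product (l ∷ ks) , bound-product k ks≢0 ,
                   cong (_* product (l ∷ ks)) (sym (m≥n⇒m⊔n≡m max≤k))
... | inj₂ k≤max with q , bound , eq ← bound-max ks≢0 =
  k * q , bound-∷ k {{k≢0}} {{q≢0}} bound , (begin
    k * product (l ∷ ks)                 ≡⟨ cong (k *_) eq ⟩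
    k * (maximum (l ∷ ks) * q)           ≡⟨ swap k (maximum (l ∷ ks)) q ⟩
    maximum (l ∷ ks) * (k * q)           ≡⟨ cong (_* (k * q)) (m≤n⇒m⊔n≡n k≤max) ⟨
    (k ⊔ maximum (l ∷ ks)) * (k * q)     ∎)
  where
  open ≡-Reasoning
  q≢0 : NonZero q
  q≢0 = m*n≢0⇒n≢0 (maximum (l ∷ ks)) {{subst NonZero eq (product≢0 ks≢0)}}
  swap : ∀ a b c → a * (b * c) ≡ b * (a * c)
  swap = solve-∀

-- From matrices to Boolean arrays.

entry : ∀ d → Matrix (cube d n) → Vec (Fin n) d → Bool
entry zero    A []      = A
entry (suc d) A (i ∷ v) = entry d (lookup A i) v

weight-entry : ∀ d (A : Matrix (cube d n)) → weight (entry d A) ≡ ones (cube d n) A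
weight-entry zero    true  = refl
weight-entry zero    false = refl
weight-entry {n} (suc d) A = trans (sum-cong-≗ λ i → weight-entry d (lookup A i)) (∑-lookup A)
  where
  ∑-lookup : ∀ {m} (A : Vec (Matrix (cube d n)) m) →
             ∑[ i < m ] ones (cube d n) (lookup A i) ≡ Vec.sum (Vec.map (ones (cube d n)) A)
  ∑-lookup []      = refl
  ∑-lookup (_ ∷ A) = cong (_+_ _) (∑-lookup A)

below-submatrix : ∀ (ks : Vec ℕ d) (A : Matrix (cube d n)) (σ : Selection (cube d n) ks) →
                  (∀ v → v ∈ₛ σ → entry d A v ≡ true) → Below ks (R ks) (submatrix σ A)
below-submatrix []       A []             full rewrite full [] tt = Bool.b≤b
below-submatrix {suc d} {n} (k ∷ ks) A ((is , _) ∷ σ) full =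
  rows is λ i∈ → below-submatrix ks (lookup A _) σ λ v v∈ → full (_ ∷ v) (i∈ , v∈)
  where
  rows : ∀ {k} (is : Vec (Fin n) k) → (∀ {i} → i ∈ is → Below ks (R ks) (submatrix σ (lookup A i))) →
         Pointwise (Below ks) (R (k ∷ ks)) (Vec.map (λ i → submatrix σ (lookup A i)) is)
  rows []       H = []
  rows (i ∷ is) H = H (here refl) ∷ rows is (H ∘ there)

avoids⇒clear : ∀ (ks : Vec ℕ d) (A : Matrix (cube d n)) →
               Avoids (cube d n) ks A (R ks) → Clear ks (entry d A)
avoids⇒clear ks A avoids σ full = avoids (σ , below-submatrix ks A σ full)

-- `f` is a maximum with default 0, so it is either 0 or the number of ones of an avoiding matrix;
-- hence the separate case `Q 0`.
f-elim : ∀ n (ks : Vec ℕ d) (P : Matrix ks) (Q : ℕ → Set) → Q 0 →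
         (∀ A → Avoids (cube d n) ks A P → Q (ones (cube d n) A)) → Q (f n ks P)
f-elim {d} n ks P Q Q0 Qones
  with argmax-sel id 0 (List.map (ones (cube d n))
         (List.filter (avoids? (cube d n) ks P) (matrices (cube d n))))
... | inj₁ f≡0 = subst Q (sym f≡0) Q0
... | inj₂ f∈
  with A , A∈ , f≡ ← ∈ₗ-map⁻ (ones (cube d n)) f∈
  with _ , avoids ← ∈ₗ-filter⁻ (avoids? (cube d n) ks P) {xs = matrices (cube d n)} A∈
  = subst Q (sym f≡) (Qones A avoids)

-- Rational exponents and the final estimate.

-- The left side is the numerator produced by unnormalised subtraction of `M / K` from `d / 1`. Its
-- being nonnegative selects the first clause of `AtMost`.
d-M/K-numerator : ∀ d M K → M ≤ d * K → + d ℤ.* + K ℤ.+ ℤ.- + M ℤ.* + 1 ≡ + (d * K ∸ M)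
d-M/K-numerator d M K M≤dK = trans (cong₂ ℤ._+_ (sym (ℤ.pos-* d K)) (ℤ.*-identityʳ (ℤ.- + M)))
                             (trans (ℤ.m-n≡m⊖n (d * K) M) (ℤ.⊖-≥ M≤dK))

-- The hypothesis is the claim multiplied by `n ^ M`, which is positive and cancels.
atMost-minus : ∀ x C n d M K .{{_ : NonZero n}} .{{_ : NonZero K}} → M ≤ d * K →
               x ^ K * n ^ M ≤ C ^ K * n ^ (d * K) → AtMost x C n (+ d / 1 - + M / K)
atMost-minus x C n d M K@(suc K-1) M≤dK bound
  rewrite +-identityʳ K-1 | d-M/K-numerator d M K M≤dK = *-cancelʳ-≤ _ _ (n ^ M) {{m^n≢0 n M}} (begin
    x ^ K * n ^ M                          ≤⟨ bound ⟩
    C ^ K * n ^ (d * K)                    ≡⟨ cong (λ e → C ^ K * n ^ e) (m∸n+n≡m M≤dK) ⟨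
    C ^ K * n ^ (d * K ∸ M + M)            ≡⟨ cong (C ^ K *_) (^-distribˡ-+-* n (d * K ∸ M) M) ⟩
    C ^ K * (n ^ (d * K ∸ M) * n ^ M)      ≡⟨ *-assoc (C ^ K) _ _ ⟨
    C ^ K * n ^ (d * K ∸ M) * n ^ M        ∎)
  where
  open ≤-Reasoning

theorem2p2 : (d : ℕ) → 1 ≤ d →
    (ks : Vec ℕ d) (ks≢0 : All NonZero ks) →
    (λ n → f n ks (R ks)) =O[n^ + d / 1 - α ks ks≢0 ]
theorem2p2 (suc d) _ ks@(_ ∷ _) ks≢0
  with q , (C , bound) , K≡Mq ← bound-max ks≢0
  -- Since `suc C` is positive, its exponent may grow from `M` to `K`; the threshold 1 makes `n`
  -- nonzero.
  = suc C , 1 , λ n 1≤n →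
    let instance
          n≢0 : NonZero n
          n≢0 = >-nonZero 1≤n
          K≢0 : NonZero K
          K≢0 = product≢0 ks≢0
          q≢0 : NonZero q
          q≢0 = m*n≢0⇒n≢0 M {{subst NonZero K≡Mq K≢0}}
        M≤K : M ≤ K
        M≤K = subst (M ≤_) (sym K≡Mq) (m≤m*n M q)
    in f-elim n ks (R ks) (λ x → AtMost x (suc C) n (+ suc d / 1 - α ks ks≢0))
         -- This is the default value 0 of the maximum.
         (atMost-minus 0 (suc C) n (suc d) M K (≤-trans M≤K (m≤m+n K _))
           (subst (_≤ suc C ^ K * n ^ (suc d * K)) (cong (_* n ^ M) (sym (0^ K))) z≤n))
         (λ A avoids → atMost-minus _ (suc C) n (suc d) M K (≤-trans M≤K (m≤m+n K _))
           (power n M≤K (subst (λ x → x ^ q * n ≤ C * (n ^ suc d) ^ q) (weight-entry (suc d) A)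
             (bound n (entry (suc d) A) (avoids⇒clear ks A avoids)))))
  where
  M = maximum ks
  K = product ks
  0^ : ∀ K .{{_ : NonZero K}} → 0 ^ K ≡ 0
  0^ (suc K) = refl
  power : ∀ {x} n → M ≤ K → x ^ q * n ≤ C * (n ^ suc d) ^ q →
          x ^ K * n ^ M ≤ suc C ^ K * n ^ (suc d * K)
  power {x} n M≤K le = begin
    x ^ K * n ^ M                      ≡⟨ cong (_* n ^ M) (trans (cong (x ^_) K≡qM) (sym (^-*-assoc x q M))) ⟩
    (x ^ q) ^ M * n ^ M                ≡⟨ ^-distribʳ-* M (x ^ q) n ⟨
    -- Because `K = q * M`, the `M`th power of the bound has the exponents that `atMost-minus`
    -- expects.
    (x ^ q * n) ^ M                    ≤⟨ ^-monoˡ-≤ M le ⟩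
    (C * (n ^ suc d) ^ q) ^ M          ≡⟨ ^-distribʳ-* M C _ ⟩
    C ^ M * ((n ^ suc d) ^ q) ^ M      ≡⟨ cong (C ^ M *_) n-exponent ⟩
    C ^ M * n ^ (suc d * K)            ≤⟨ *-monoˡ-≤ _ (≤-trans (^-monoˡ-≤ M (n≤1+n C)) (^-monoʳ-≤ (suc C) M≤K)) ⟩
    suc C ^ K * n ^ (suc d * K)        ∎
    where
    open ≤-Reasoning
    K≡qM : K ≡ q * M
    K≡qM = trans K≡Mq (*-comm M q)
    n-exponent : ((n ^ suc d) ^ q) ^ M ≡ n ^ (suc d * K)
    n-exponent = trans (^-*-assoc (n ^ suc d) q M)
      (trans (cong ((n ^ suc d) ^_) (sym K≡qM)) (^-*-assoc n (suc d) K))
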